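{- Let $k\ge 1$ and $t\ge 1$ be integers and let $c\colon E(K_{2kt+1})\to[k]$ be a colour-balanced $k$-edge-colouring of the complete graph $K_{2kt+1}$. Then there is a colour-balanced spanning tree of $K_{2kt+1}$.
   Context: $[k]=\{1,\dots,k\}$. A $k$-edge-colouring is an arbitrary (not necessarily proper) map from the edge set to $[k]$; it is colour-balanced if all $k$ colour classes have the same size. A subgraph is colour-balanced if each of the $k$ colours appears on equally many of its edges (so a colour-balanced spanning tree of $K_{2kt+1}$ has exactly $2t$ edges of each colour). -}

module Defs where

open import Data.Bool using (Bool; true; T)
open import Data.Fin using (Fin; zero; suc; inject₁; fromℕ; _<_; _≟_; _<?_)
open import Data.List using (List; []; _∷_; length; filter; filterᵇ; mapMaybe; allFin; cartesianProduct)
open import Data.List.Membership.Propositional using (_∈_)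
open import Data.List.Membership.Propositional.Properties using (∈-cartesianProduct⁺; ∈-allFin)
import Data.List.Relation.Unary.All as All
import Data.List.Relation.Unary.All.Properties as All
open import Data.List.Relation.Unary.AllPairs using ([]; _∷_)
import Data.List.Relation.Unary.Any as Any
import Data.List.Relation.Unary.Any.Properties as Any
open import Data.List.Relation.Unary.Unique.Propositional using (Unique)
open import Data.List.Relation.Unary.Unique.Propositional.Properties using (cartesianProduct⁺; allFin⁺)
open import Data.Maybe using (Maybe; just; nothing)
import Data.Maybe.Relation.Unary.All as Maybe
import Data.Maybe.Relation.Unary.Any as Maybe
open import Data.Nat using (ℕ; _+_)
open import Data.Product using (_×_; _,_; proj₁; proj₂; Σ-syntax)
open import Data.Sum using (_⊎_)
open import Function.Definitions using (Injective)
open import Relation.Binary.Construct.Closure.ReflexiveTransitive using (Star)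
open import Relation.Binary.PropositionalEquality using (_≡_; _≢_; refl)
open import Relation.Nullary using (¬_; yes; no)
open import Relation.Nullary.Negation.Core using (contradiction-irr)

-- An edge of the complete graph on Fin n: the unordered pair {lo , hi} is
-- represented by its increasing ordering.  The proof is irrelevant, so each
-- unordered pair of distinct vertices is exactly one element.
record Edge (n : ℕ) : Set where
  constructor edge
  field
    lo hi  : Fin n
    .lo<hi : lo < hi

open Edge public

toEdge : ∀ {n} → Fin n × Fin n → Maybe (Edge n)
toEdge (u , v) with u <? v
... | yes u<v = just (edge u v u<v)
... | no  _   = nothing

allEdges : ∀ n → List (Edge n)
allEdges n = mapMaybe toEdge (cartesianProduct (allFin n) (allFin n))

∈-allEdges : ∀ {n} (e : Edge n) → e ∈ allEdges n
∈-allEdges (edge u v u<v) =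
  Any.mapMaybe⁺ toEdge _
    (Any.map⁺ (Any.map (λ { refl → hit })
                   (∈-cartesianProduct⁺ (∈-allFin u) (∈-allFin v))))
  where
  hit : Maybe.Any (edge u v u<v ≡_) (toEdge (u , v))
  hit with u <? v
  ... | yes _   = Maybe.just refl
  ... | no  u≮v = contradiction-irr u<v u≮v

allEdges-unique : ∀ n → Unique (allEdges n)
allEdges-unique n = go (cartesianProduct⁺ (allFin⁺ n) (allFin⁺ n))
  where
  separate : ∀ {n} {p : Fin n × Fin n} (u<v : proj₁ p < proj₂ p) (q : Fin n × Fin n) → p ≢ q →
             Maybe.All (edge (proj₁ p) (proj₂ p) u<v ≢_) (toEdge q)
  separate u<v (x , y) p≢q with x <? y
  ... | yes _ = Maybe.just λ { refl → p≢q refl }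
  ... | no  _ = Maybe.nothing

  go : ∀ {ps} → Unique ps → Unique (mapMaybe toEdge ps)
  go []                             = []
  go {(u , v) ∷ _} (p∉ps ∷ ps!) with u <? v
  ... | yes u<v = All.mapMaybe⁺ (All.map⁺ (All.map (separate u<v _) p∉ps)) ∷ go ps!
  ... | no  _   = go ps!

-- A spanning subgraph of the complete graph on Fin n, given by its edge set;
-- its vertex set is all of Fin n.
SpanningSubgraph : ℕ → Set
SpanningSubgraph n = Edge n → Bool

complete : ∀ n → SpanningSubgraph n
complete n _ = true

edges : ∀ {n} → SpanningSubgraph n → List (Edge n)
edges {n} G = filterᵇ G (allEdges n)

Adj : ∀ {n} → SpanningSubgraph n → Fin n → Fin n → Set
Adj {n} G u v =
  Σ[ e ∈ Edge n ] T (G e) × ((lo e ≡ u × hi e ≡ v) ⊎ (lo e ≡ v × hi e ≡ u))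

Connected : ∀ {n} → SpanningSubgraph n → Set
Connected {n} G = (u v : Fin n) → Star (Adj G) u v

-- A cycle on 3 + m distinct vertices.
record Cycle {n : ℕ} (G : SpanningSubgraph n) : Set where
  field
    m        : ℕ
    vertex   : Fin (3 + m) → Fin n
    distinct : Injective _≡_ _≡_ vertex
    step     : (i : Fin (2 + m)) → Adj G (vertex (inject₁ i)) (vertex (suc i))
    close    : Adj G (vertex (fromℕ (2 + m))) (vertex zero)

IsSpanningTree : ∀ {n} → SpanningSubgraph n → Set
IsSpanningTree G = Connected G × ¬ Cycle G

EdgeColouring : ℕ → ℕ → Set
EdgeColouring n k = Edge n → Fin k

colourCount : ∀ {n k} → EdgeColouring n k → SpanningSubgraph n → Fin k → ℕ
colourCount c G i = length (filter (λ e → c e ≟ i) (edges G))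

-- The colouring c itself is colour-balanced when this holds for the complete
-- graph.
ColourBalanced : ∀ {n k} → EdgeColouring n k → SpanningSubgraph n → Set
ColourBalanced {k = k} c G = (i j : Fin k) → colourCount c G i ≡ colourCount c G j

module Submission where

open import Defs
open import Data.Bool using (true; false; if_then_else_)
open import Data.Fin using (Fin; zero; suc; toℕ; inject₁; fromℕ; _≟_; _<?_)
open import Data.Fin.Properties
  using (toℕ-injective; <⇒≢; <-cmp; toℕ<n; fromℕ≢inject₁)
open import Data.Fin.Subset using (Subset; ∣_∣; _∪_; _∩_; inside; outside)
  renaming (_∈_ to _∈ˢ_; _⊆_ to _⊆ˢ_)
import Data.Fin.Subset as Subset
open import Data.Fin.Subset.Properties using (anySubset?; x∈p∪q⁻; p⊆p∪q; q⊆p∪q; p∩q⊆p; p∩q⊆q)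
open import Data.List
  using (List; []; _∷_; _++_; length; lookup; map; concat; concatMap; replicate; filter;
         allFin; cartesianProduct)
import Data.List.Membership.DecPropositional as DecMembership
open import Data.List.Membership.Propositional using (_∈_)
open import Data.List.Membership.Propositional.Properties
  using (∈-++⁺ˡ; ∈-++⁺ʳ; ∈-++⁻; ∈-∃++; ∈-map⁺; ∈-filter⁺; ∈-filter⁻; ∈-allFin; ∈-concatMap⁺)
open import Data.List.Properties
  using (length-map; length-++; length-tabulate; filter-++; filter-all; filter-none; ++-identityʳ)
open import Data.List.Relation.Binary.Permutation.Propositional
  using (_↭_; refl; prep; swap; trans; ↭-sym)
open import Data.List.Relation.Binary.Permutation.Propositional.Properties
  using (∈-resp-↭; ++-comm; shift; ↭-length)
open import Data.List.Relation.Binary.Pointwise using (Pointwise; []; _∷_)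
import Data.List.Relation.Binary.Pointwise as Pointwise
open import Data.List.Relation.Binary.Sublist.Heterogeneous using (Sublist; []; _∷_; _∷ʳ_)
import Data.List.Relation.Binary.Sublist.Heterogeneous.Properties as Sublist
open import Data.List.Relation.Binary.Subset.Propositional using (_⊆_)
open import Data.List.Relation.Binary.Subset.Propositional.Properties using (filter-⊆; filter⁺′)
open import Data.List.Relation.Unary.All using (All; []; _∷_)
import Data.List.Relation.Unary.All as All
open import Data.List.Relation.Unary.AllPairs using ([]; _∷_)
open import Data.List.Relation.Unary.Any using (here; there)
import Data.List.Relation.Unary.Any as Any
open import Data.List.Relation.Unary.Unique.Propositional using (Unique)
open import Data.List.Relation.Unary.Unique.Propositional.Properties
  using (cartesianProduct⁺; allFin⁺) renaming (filter⁺ to unique-filter⁺)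
open import Data.Nat using (ℕ; zero; suc; _+_; _*_; _≥_; _≤_; z≤n; s≤s; NonZero)
import Data.Nat as ℕ
open import Data.Nat.Properties hiding (_≟_; _<?_; <-cmp; <⇒≢)
open import Data.Nat.Tactic.RingSolver using (solve-∀)
open import Data.Product using (_×_; _,_; ∃-syntax; proj₁; proj₂; map₁)
open import Data.Sum using (_⊎_; inj₁; inj₂; [_,_]′)
import Data.Sum as Sum
open import Data.Vec using ([]; _∷_; here; there)
open import Function using (_∘_; id)
open import Relation.Binary using (Decidable; DecidableEquality; tri<; tri≈; tri>)
open import Relation.Binary.Construct.Closure.ReflexiveTransitive using (Star; ε; _◅_; _◅◅_; _⋆)
import Relation.Binary.Construct.Closure.ReflexiveTransitive as Star
open import Relation.Binary.PropositionalEquality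
  using (_≡_; _≢_; refl; sym; cong; cong₂; subst; subst₂)
import Relation.Binary.PropositionalEquality as ≡
open import Relation.Nullary using (¬_; Dec; yes; no; contradiction; does)
open import Relation.Nullary.Decidable
  using (decidable-stable; recompute; map′; _×-dec_; _⊎-dec_; ¬?; isYes; toWitness; fromWitness)
open import Algebra.Properties.CommutativeMonoid.Sum +-0-commutativeMonoid
  using (sum; sum-cong-≗; sum-replicate-zero; ∑-distrib-+)
open import Algebra.Properties.Semiring.Sum +-*-semiring using (*-distribˡ-sum)

-- A balanced spanning tree is an independent transversal, in the graphic matroid,
-- of the colour classes each repeated 2t times.  By Rado's theorem it exists
-- unless some chosen s of these sets have a union of rank r < s.  Each class has
-- t(2kt+1) edges and is chosen at most 2t times, so the union has at least
-- s(2kt+1)/2 edges, whereas a graph of rank r has at most r(r+1)/2 edges; since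
-- r + 1 ≤ s ≤ 2kt this is impossible.

-- Rado's theorem

-- Repeating every class 2t times turns the colour quota into a plain transversal, one edge per
-- entry of a list of 2kt colours. An independent transversal cannot use an edge twice, and 2kt
-- independent edges on 2kt + 1 vertices also span, so distinctness, acyclicity and connectedness
-- all come from one rank inequality. A decidable closure is the primitive notion because for graphs
-- it is reachability, and rank can be computed from it. Lists stand for finite sets: by `cl-mono`,
-- order and repetition do not affect closure. `cl-cut` is idempotence, one generator at a time.

record Matroid (E : Set) : Set₁ where
  field
    _∈cl_       : E → List E → Set
    _∈cl?_      : Decidable _∈cl_
    cl-ext      : ∀ {L x} → x ∈ L → x ∈cl L
    cl-mono     : ∀ {L M x} → L ⊆ M → x ∈cl L → x ∈cl M
    cl-cut      : ∀ {L x y} → x ∈cl (y ∷ L) → y ∈cl L → x ∈cl L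
    cl-exchange : ∀ {L x y} → x ∈cl (y ∷ L) → ¬ x ∈cl L → y ∈cl (x ∷ L)

++-⊆ : ∀ {A : Set} {xs ys zs : List A} → xs ⊆ zs → ys ⊆ zs → xs ++ ys ⊆ zs
++-⊆ {xs = xs} xs⊆ ys⊆ y∈ = [ xs⊆ , ys⊆ ]′ (∈-++⁻ xs y∈)

select : ∀ {A : Set} (xs : List A) → Subset (length xs) → List A
select []       []            = []
select (x ∷ xs) (inside  ∷ p) = x ∷ select xs p
select (x ∷ xs) (outside ∷ p) = select xs p

length-select : ∀ {A : Set} (xs : List A) p → length (select xs p) ≡ ∣ p ∣
length-select []       []            = refl
length-select (x ∷ xs) (inside  ∷ p) = cong suc (length-select xs p)
length-select (x ∷ xs) (outside ∷ p) = length-select xs p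

∣p∪q∣+∣p∩q∣≡∣p∣+∣q∣ : ∀ {n} (p q : Subset n) → ∣ p ∪ q ∣ + ∣ p ∩ q ∣ ≡ ∣ p ∣ + ∣ q ∣
∣p∪q∣+∣p∩q∣≡∣p∣+∣q∣ []            []            = refl
∣p∪q∣+∣p∩q∣≡∣p∣+∣q∣ (inside ∷ p)  (inside ∷ q)  =
  cong suc (≡.trans (+-suc _ _) (≡.trans (cong suc (∣p∪q∣+∣p∩q∣≡∣p∣+∣q∣ p q)) (sym (+-suc _ _))))
∣p∪q∣+∣p∩q∣≡∣p∣+∣q∣ (inside ∷ p)  (outside ∷ q) = cong suc (∣p∪q∣+∣p∩q∣≡∣p∣+∣q∣ p q)
∣p∪q∣+∣p∩q∣≡∣p∣+∣q∣ (outside ∷ p) (inside ∷ q)  =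
  ≡.trans (cong suc (∣p∪q∣+∣p∩q∣≡∣p∣+∣q∣ p q)) (sym (+-suc _ _))
∣p∪q∣+∣p∩q∣≡∣p∣+∣q∣ (outside ∷ p) (outside ∷ q) = ∣p∪q∣+∣p∩q∣≡∣p∣+∣q∣ p q

module _ {A B : Set} (f : A → List B) where

  selectMap : (xs : List A) → Subset (length xs) → List B
  selectMap xs p = concatMap f (select xs p)

  ∈-selectMap⁺ : ∀ xs {p i y} → i ∈ˢ p → y ∈ f (lookup xs i) → y ∈ selectMap xs p
  ∈-selectMap⁺ (x ∷ xs)                here        y∈ = ∈-++⁺ˡ y∈
  ∈-selectMap⁺ (x ∷ xs) {inside  ∷ p} (there i∈p) y∈ = ∈-++⁺ʳ (f x) (∈-selectMap⁺ xs i∈p y∈)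
  ∈-selectMap⁺ (x ∷ xs) {outside ∷ p} (there i∈p) y∈ = ∈-selectMap⁺ xs i∈p y∈

  ∈-selectMap⁻ : ∀ xs p {y} → y ∈ selectMap xs p → ∃[ i ] (i ∈ˢ p × y ∈ f (lookup xs i))
  ∈-selectMap⁻ []       []            ()
  ∈-selectMap⁻ (x ∷ xs) (outside ∷ p) y∈ with i , i∈p , y∈fi ← ∈-selectMap⁻ xs p y∈ =
    suc i , there i∈p , y∈fi
  ∈-selectMap⁻ (x ∷ xs) (inside ∷ p)  y∈ with ∈-++⁻ (f x) y∈
  ... | inj₁ y∈fx = zero , here , y∈fx
  ... | inj₂ y∈ys with i , i∈p , y∈fi ← ∈-selectMap⁻ xs p y∈ys = suc i , there i∈p , y∈fi

  selectMap-mono : ∀ xs {p q} → p ⊆ˢ q → selectMap xs p ⊆ selectMap xs q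
  selectMap-mono xs p⊆q y∈ with i , i∈p , y∈fi ← ∈-selectMap⁻ xs _ y∈ = ∈-selectMap⁺ xs (p⊆q i∈p) y∈fi

  selectMap-∪ : ∀ xs p q → selectMap xs (p ∪ q) ⊆ selectMap xs p ++ selectMap xs q
  selectMap-∪ xs p q y∈ with ∈-selectMap⁻ xs (p ∪ q) y∈
  ... | i , i∈p∪q , y∈fi with x∈p∪q⁻ p q i∈p∪q
  ...   | inj₁ i∈p = ∈-++⁺ˡ (∈-selectMap⁺ xs i∈p y∈fi)
  ...   | inj₂ i∈q = ∈-++⁺ʳ (selectMap xs p) (∈-selectMap⁺ xs i∈q y∈fi)

  selectMap-⊥ : ∀ xs → selectMap xs Subset.⊥ ≡ []
  selectMap-⊥ []       = refl
  selectMap-⊥ (x ∷ xs) = selectMap-⊥ xs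

module Rank {E : Set} (M : Matroid E) where
  open Matroid M

  -- A greedy count along the list. That the order does not matter is a theorem, `rank-↭`, and the
  -- one place where the exchange axiom is used.
  rank : List E → ℕ
  rank []      = 0
  rank (x ∷ L) with x ∈cl? L
  ... | yes _ = rank L
  ... | no  _ = suc (rank L)

  rank-∈cl : ∀ {x L} → x ∈cl L → rank (x ∷ L) ≡ rank L
  rank-∈cl {x} {L} x∈ with x ∈cl? L
  ... | yes _  = refl
  ... | no  x∉ = contradiction x∈ x∉

  rank-∉cl : ∀ {x L} → ¬ x ∈cl L → rank (x ∷ L) ≡ suc (rank L)
  rank-∉cl {x} {L} x∉ with x ∈cl? L
  ... | yes x∈ = contradiction x∈ x∉
  ... | no  _  = refl

  rank-∷-≤ : ∀ x L → rank (x ∷ L) ≤ suc (rank L)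
  rank-∷-≤ x L with x ∈cl? L
  ... | yes _ = n≤1+n _
  ... | no  _ = ≤-refl

  rank-∷-≥ : ∀ x L → rank L ≤ rank (x ∷ L)
  rank-∷-≥ x L with x ∈cl? L
  ... | yes _ = ≤-refl
  ... | no  _ = n≤1+n _

  rank≤length : ∀ L → rank L ≤ length L
  rank≤length []      = z≤n
  rank≤length (x ∷ L) = ≤-trans (rank-∷-≤ x L) (s≤s (rank≤length L))

  rank-cong-∷ : ∀ {x L N} → (x ∈cl L → x ∈cl N) → (x ∈cl N → x ∈cl L) →
                rank L ≡ rank N → rank (x ∷ L) ≡ rank (x ∷ N)
  rank-cong-∷ {x} {L} {N} to from eq with x ∈cl? L
  ... | yes x∈ = ≡.trans eq (sym (rank-∈cl (to x∈)))
  ... | no  x∉ = ≡.trans (cong suc eq) (sym (rank-∉cl λ x∈ → x∉ (from x∈)))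

  -- If x or y lies in the closure of L, it contributes nothing in either order. Otherwise exchange
  -- makes `x ∈cl (y ∷ L)` and `y ∈cl (x ∷ L)` equivalent, so both orders add one or both add two.
  rank-swap : ∀ x y L → rank (x ∷ y ∷ L) ≡ rank (y ∷ x ∷ L)
  rank-swap x y L = go (x ∈cl? L) (y ∈cl? L)
    where
    go : Dec (x ∈cl L) → Dec (y ∈cl L) → rank (x ∷ y ∷ L) ≡ rank (y ∷ x ∷ L)
    go (yes x∈) _        = ≡.trans (rank-∈cl (cl-mono there x∈))
      (rank-cong-∷ (cl-mono there) (λ y∈ → cl-cut y∈ x∈) (sym (rank-∈cl x∈)))
    go (no _)   (yes y∈) = sym (≡.trans (rank-∈cl (cl-mono there y∈))
      (rank-cong-∷ (cl-mono there) (λ x∈ → cl-cut x∈ y∈) (sym (rank-∈cl y∈))))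
    go (no x∉)  (no y∉)  with x ∈cl? (y ∷ L)
    ... | yes x∈ = ≡.trans (rank-∉cl y∉)
      (≡.trans (sym (rank-∉cl x∉)) (sym (rank-∈cl (cl-exchange x∈ x∉))))
    ... | no x∉′ = ≡.trans (cong suc (≡.trans (rank-∉cl y∉) (sym (rank-∉cl x∉))))
      (sym (rank-∉cl λ y∈ → x∉′ (cl-exchange y∈ y∉)))

  rank-↭ : ∀ {L N} → L ↭ N → rank L ≡ rank N
  rank-↭ refl           = refl
  rank-↭ (prep x p)     = rank-cong-∷ (cl-mono (∈-resp-↭ p)) (cl-mono (∈-resp-↭ (↭-sym p))) (rank-↭ p)
  rank-↭ (swap x y p)   = ≡.trans (rank-swap x y _)
    (rank-cong-∷ (cl-mono (∈-resp-↭ (prep x p))) (cl-mono (∈-resp-↭ (prep x (↭-sym p))))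
      (rank-cong-∷ (cl-mono (∈-resp-↭ p)) (cl-mono (∈-resp-↭ (↭-sym p))) (rank-↭ p)))
  rank-↭ (trans p q)    = ≡.trans (rank-↭ p) (rank-↭ q)

  rank-++ʳ : ∀ L N → rank N ≤ rank (L ++ N)
  rank-++ʳ []      N = ≤-refl
  rank-++ʳ (x ∷ L) N = ≤-trans (rank-++ʳ L N) (rank-∷-≥ x (L ++ N))

  rank-++-absorb : ∀ {L N} → All (_∈cl N) L → rank (L ++ N) ≡ rank N
  rank-++-absorb {[]}    []        = refl
  rank-++-absorb {x ∷ L} (x∈ ∷ L⊆) =
    ≡.trans (rank-∈cl (cl-mono (∈-++⁺ʳ L) x∈)) (rank-++-absorb L⊆)

  rank-mono-cl : ∀ {L N} → All (_∈cl N) L → rank L ≤ rank N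
  rank-mono-cl {L} {N} L⊆ = begin
    rank L        ≤⟨ rank-++ʳ N L ⟩
    rank (N ++ L) ≡⟨ rank-↭ (++-comm N L) ⟩
    rank (L ++ N) ≡⟨ rank-++-absorb L⊆ ⟩
    rank N        ∎
    where open ≤-Reasoning

  rank-mono : ∀ {L N} → L ⊆ N → rank L ≤ rank N
  rank-mono L⊆N = rank-mono-cl (All.tabulate λ x∈ → cl-ext (L⊆N x∈))

  -- Diminishing returns: an element that raises the rank over the larger list is outside its
  -- closure, hence outside the closure of the smaller one, and raises the rank there too.
  rank-submodular-++ : ∀ K L N → rank (K ++ L ++ N) + rank N ≤ rank (K ++ N) + rank (L ++ N)
  rank-submodular-++ []      L N = ≤-reflexive (+-comm (rank (L ++ N)) (rank N))
  rank-submodular-++ (x ∷ K) L N with x ∈cl? (K ++ N)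
  ... | no  _  = ≤-trans (+-monoˡ-≤ (rank N) (rank-∷-≤ x (K ++ L ++ N)))
                         (s≤s (rank-submodular-++ K L N))
  ... | yes x∈ = subst (λ r → r + rank N ≤ rank (K ++ N) + rank (L ++ N))
                       (sym (rank-∈cl (cl-mono insert x∈)))
                       (rank-submodular-++ K L N)
    where
    insert : K ++ N ⊆ K ++ L ++ N
    insert y∈ with ∈-++⁻ K y∈
    ... | inj₁ y∈K = ∈-++⁺ˡ y∈K
    ... | inj₂ y∈N = ∈-++⁺ʳ K (∈-++⁺ʳ L y∈N)

  -- N is any common part instead of the intersection, because the sets selected by `p ∩ q` may
  -- cover less than what the selections p and q have in common.
  rank-submodular : ∀ {K L U N} → U ⊆ K ++ L → N ⊆ K → N ⊆ L → rank U + rank N ≤ rank K + rank L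
  rank-submodular {K} {L} {U} {N} U⊆ N⊆K N⊆L = begin
    rank U + rank N               ≤⟨ +-monoˡ-≤ (rank N) (rank-mono (λ y∈ → widen (U⊆ y∈))) ⟩
    rank (K ++ L ++ N) + rank N   ≤⟨ rank-submodular-++ K L N ⟩
    rank (K ++ N) + rank (L ++ N) ≤⟨ +-mono-≤ (absorb N⊆K) (absorb N⊆L) ⟩
    rank K + rank L               ∎
    where
    open ≤-Reasoning
    widen : K ++ L ⊆ K ++ L ++ N
    widen y∈ with ∈-++⁻ K y∈
    ... | inj₁ y∈K = ∈-++⁺ˡ y∈K
    ... | inj₂ y∈L = ∈-++⁺ʳ K (∈-++⁺ˡ y∈L)
    absorb : ∀ {J} → N ⊆ J → rank (J ++ N) ≤ rank J
    absorb N⊆J = rank-mono (++-⊆ id N⊆J)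

  module _ {C : Set} (f : C → List E) where

    private
      sel : (cs : List C) (B : List E) → Subset (length cs) → List E
      sel cs B p = selectMap f cs p ++ B

    -- Hall's condition relative to B, i.e. in the contraction by B.
    RadoCondition : List C → List E → Set
    RadoCondition cs B = ∀ p → ∣ p ∣ + rank B ≤ rank (sel cs B p)

    private
      sel-mono : ∀ cs B {p q} → p ⊆ˢ q → sel cs B p ⊆ sel cs B q
      sel-mono cs B {q = q} p⊆q = ++-⊆ (∈-++⁺ˡ ∘ selectMap-mono f cs p⊆q) (∈-++⁺ʳ (selectMap f cs q))

      -- Equality in the condition; the other inequality is supplied by `RadoCondition`.
      Tight : (cs : List C) (B : List E) → Subset (length cs) → Set
      Tight cs B p = rank (sel cs B p) ≤ ∣ p ∣ + rank B

      tight-⊥ : ∀ cs B → Tight cs B Subset.⊥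
      tight-⊥ cs B = ≤-trans (≤-reflexive (cong (λ L → rank (L ++ B)) (selectMap-⊥ f cs)))
                             (m≤n+m (rank B) _)

      -- Uncrossing: cardinality is modular and rank submodular, while the condition bounds the rank
      -- for `p ∩ q` from below, so no slack is left for `p ∪ q`.
      tight-∪ : ∀ {cs B p q} → RadoCondition cs B → Tight cs B p → Tight cs B q → Tight cs B (p ∪ q)
      tight-∪ {cs} {B} {p} {q} rc tp tq = +-cancelʳ-≤ (∣ p ∩ q ∣ + rank B) _ _ (begin
        rank (sel cs B (p ∪ q)) + (∣ p ∩ q ∣ + rank B)
          ≤⟨ +-monoʳ-≤ (rank (sel cs B (p ∪ q))) (rc (p ∩ q)) ⟩
        rank (sel cs B (p ∪ q)) + rank (sel cs B (p ∩ q))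
          ≤⟨ rank-submodular union (sel-mono cs B (p∩q⊆p p q)) (sel-mono cs B (p∩q⊆q p q)) ⟩
        rank (sel cs B p) + rank (sel cs B q)
          ≤⟨ +-mono-≤ tp tq ⟩
        ∣ p ∣ + rank B + (∣ q ∣ + rank B)
          ≡⟨ rearrange ∣ p ∣ ∣ q ∣ (rank B) ⟩
        ∣ p ∣ + ∣ q ∣ + (rank B + rank B)
          ≡⟨ cong (_+ (rank B + rank B)) (∣p∪q∣+∣p∩q∣≡∣p∣+∣q∣ p q) ⟨
        ∣ p ∪ q ∣ + ∣ p ∩ q ∣ + (rank B + rank B)
          ≡⟨ rearrange ∣ p ∪ q ∣ ∣ p ∩ q ∣ (rank B) ⟨
        ∣ p ∪ q ∣ + rank B + (∣ p ∩ q ∣ + rank B) ∎)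
        where
        open ≤-Reasoning
        rearrange : ∀ a b r → a + r + (b + r) ≡ a + b + (r + r)
        rearrange = solve-∀
        union : sel cs B (p ∪ q) ⊆ sel cs B p ++ sel cs B q
        union = ++-⊆ (++-⊆ (∈-++⁺ˡ ∘ ∈-++⁺ˡ {xs = selectMap f cs p})
                           (∈-++⁺ʳ (sel cs B p) ∘ ∈-++⁺ˡ {xs = selectMap f cs q})
                      ∘ selectMap-∪ f cs p q)
                     (∈-++⁺ˡ ∘ ∈-++⁺ʳ (selectMap f cs p))

      -- The `suc` accounts for x itself: on the empty selection it puts x outside the closure of B,
      -- and in general it gives the condition for cs relative to `x ∷ B`.
      Extends : (cs : List C) (B : List E) → E → Set
      Extends cs B x = ∀ p → suc (∣ p ∣ + rank B) ≤ rank (x ∷ sel cs B p)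

      extend-or-tight : ∀ {cs B} → RadoCondition cs B → ∀ xs →
        (∃[ x ] (x ∈ xs × Extends cs B x)) ⊎
        (∃[ p ] (Tight cs B p × All (_∈cl sel cs B p) xs))
      extend-or-tight {cs} {B} rc []       = inj₂ (Subset.⊥ , tight-⊥ cs B , [])
      extend-or-tight {cs} {B} rc (x ∷ xs) with extend-or-tight {cs} {B} rc xs
      ... | inj₁ (y , y∈ , ext) = inj₁ (y , there y∈ , ext)
      ... | inj₂ (p , tp , xs⊆) with anySubset? (λ q → rank (x ∷ sel cs B q) ≤? ∣ q ∣ + rank B)
      ...   | no  none     = inj₁ (x , here refl , λ q → ≰⇒> λ le → none (q , le))
      ...   | yes (q , le) = inj₂ (p ∪ q , tight-∪ {cs} {B} {p} {q} rc tp (≤-trans (rank-∷-≥ x _) le) ,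
                                   cl-mono (sel-mono cs B (q⊆p∪q p q)) x∈cl ∷
                                   All.map (cl-mono (sel-mono cs B (p⊆p∪q q))) xs⊆)
        where
        -- Outside the closure, x would lift the rank to at least `suc (∣ q ∣ + rank B)`, which q
        -- was found to violate.
        x∈cl : x ∈cl sel cs B q
        x∈cl = decidable-stable (x ∈cl? sel cs B q) λ x∉ →
          <⇒≱ (≤-trans (s≤s (rc q)) (≤-reflexive (sym (rank-∉cl x∉)))) le

    -- If no element of f c extends every selection from cs, then by submodularity
    -- the tight selections that obstruct them have a tight union, whose closure
    -- contains f c, against the condition.
    rado : ∀ cs B → RadoCondition cs B →
           ∃[ xs ] (Pointwise (λ x c → x ∈ f c) xs cs × length cs + rank B ≤ rank (xs ++ B))
    rado []       B rc = [] , [] , ≤-refl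
    rado (c ∷ cs) B rc with extend-or-tight {cs} {B} (λ p → rc (outside ∷ p)) (f c)
    ... | inj₂ (p , tp , fc⊆) = contradiction (begin-strict
        rank (sel (c ∷ cs) B (inside ∷ p)) ≤⟨ rank-mono-cl (All.tabulate absorbed) ⟩
        rank (sel cs B p)                  ≤⟨ tp ⟩
        ∣ p ∣ + rank B                     <⟨ rc (inside ∷ p) ⟩
        rank (sel (c ∷ cs) B (inside ∷ p)) ∎) (<-irrefl refl)
      where
      open ≤-Reasoning
      absorbed : ∀ {y} → y ∈ sel (c ∷ cs) B (inside ∷ p) → y ∈cl sel cs B p
      absorbed y∈ with ∈-++⁻ (f c ++ selectMap f cs p) y∈
      ... | inj₂ y∈B = cl-ext (∈-++⁺ʳ (selectMap f cs p) y∈B)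
      ... | inj₁ y∈f with ∈-++⁻ (f c) y∈f
      ...   | inj₁ y∈fc = All.lookup fc⊆ y∈fc
      ...   | inj₂ y∈p  = cl-ext (∈-++⁺ˡ y∈p)
    ... | inj₁ (x , x∈ , ext) = x ∷ xs , x∈ ∷ xs∈ , ≤-trans total
                                  (≤-reflexive (rank-↭ (shift x xs B)))
      where
      contracted : RadoCondition cs (x ∷ B)
      contracted p = begin
        ∣ p ∣ + rank (x ∷ B)             ≤⟨ +-monoʳ-≤ ∣ p ∣ (rank-∷-≤ x B) ⟩
        ∣ p ∣ + suc (rank B)             ≡⟨ +-suc ∣ p ∣ (rank B) ⟩
        suc (∣ p ∣ + rank B)             ≤⟨ ext p ⟩
        rank (x ∷ sel cs B p)            ≡⟨ rank-↭ (shift x (selectMap f cs p) B) ⟨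
        rank (selectMap f cs p ++ x ∷ B) ∎
        where open ≤-Reasoning
      rec = rado cs (x ∷ B) contracted
      xs  = proj₁ rec
      xs∈ = proj₁ (proj₂ rec)
      total : suc (length cs + rank B) ≤ rank (xs ++ x ∷ B)
      total = begin
        suc (length cs + rank B)   ≡⟨ +-suc (length cs) (rank B) ⟨
        length cs + suc (rank B)   ≤⟨ +-monoʳ-≤ (length cs) step ⟩
        length cs + rank (x ∷ B)   ≤⟨ proj₂ (proj₂ rec) ⟩
        rank (xs ++ x ∷ B)         ∎
        where
        open ≤-Reasoning
        step : suc (rank B) ≤ rank (x ∷ B)
        step = ≤-trans (+-monoˡ-≤ (rank B) (s≤s z≤n)) (≤-trans (ext Subset.⊥)
          (≤-reflexive (cong (λ L → rank (x ∷ L ++ B)) (selectMap-⊥ f cs))))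

pigeonhole : ∀ {A : Set} {xs ys : List A} → Unique xs → xs ⊆ ys → length xs ≤ length ys
pigeonhole []          _      = z≤n
pigeonhole {xs = x ∷ xs} (x∉ ∷ xs!) xs⊆ys with as , bs , refl ← ∈-∃++ (xs⊆ys (here refl)) = begin
  suc (length xs)               ≤⟨ s≤s (pigeonhole xs! avoid) ⟩
  suc (length (as ++ bs))       ≡⟨ cong suc (length-++ as) ⟩
  suc (length as + length bs)   ≡⟨ +-suc (length as) (length bs) ⟨
  length as + suc (length bs)   ≡⟨ length-++ as ⟨
  length (as ++ x ∷ bs)         ∎
  where
  open ≤-Reasoning
  avoid : xs ⊆ as ++ bs
  avoid y∈ with ∈-++⁻ as (xs⊆ys (there y∈))
  ... | inj₁ y∈as         = ∈-++⁺ˡ y∈as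
  ... | inj₂ (here refl)  = contradiction refl (All.lookup x∉ y∈)
  ... | inj₂ (there y∈bs) = ∈-++⁺ʳ as y∈bs

-- The graphic matroid

lo≢hi : ∀ {n} (e : Edge n) → lo e ≢ hi e
lo≢hi (edge u v u<v) = <⇒≢ (recompute (u <? v) u<v)

_≟ᵉ_ : ∀ {n} → DecidableEquality (Edge n)
edge u v _ ≟ᵉ edge u′ v′ _ =
  map′ (λ { (refl , refl) → refl }) (λ { refl → refl , refl }) (u ≟ u′ ×-dec v ≟ v′)

Joins : ∀ {n} → Edge n → Fin n → Fin n → Set
Joins e u v = (lo e ≡ u × hi e ≡ v) ⊎ (lo e ≡ v × hi e ≡ u)

joins-unique : ∀ {n} (e : Edge n) {u v u′ v′} → Joins e u v → Joins e u′ v′ →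
               (u ≡ u′ × v ≡ v′) ⊎ (u ≡ v′ × v ≡ u′)
joins-unique e (inj₁ (refl , refl)) (inj₁ (refl , refl)) = inj₁ (refl , refl)
joins-unique e (inj₁ (refl , refl)) (inj₂ (refl , refl)) = inj₂ (refl , refl)
joins-unique e (inj₂ (refl , refl)) (inj₁ (refl , refl)) = inj₂ (refl , refl)
joins-unique e (inj₂ (refl , refl)) (inj₂ (refl , refl)) = inj₁ (refl , refl)

Link : ∀ {n} → List (Edge n) → Fin n → Fin n → Set
Link L u v = ∃[ e ] (e ∈ L × Joins e u v)

Reach : ∀ {n} → List (Edge n) → Fin n → Fin n → Set
Reach L = Star (Link L)

module _ {n : ℕ} where

  reach-sym : ∀ {L : List (Edge n)} {u v} → Reach L u v → Reach L v u
  reach-sym = Star.reverse λ (e , e∈ , j) → e , e∈ , Sum.swap j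

  reach-mono : ∀ {L N : List (Edge n)} {u v} → L ⊆ N → Reach L u v → Reach N u v
  reach-mono L⊆N = Star.map λ (e , e∈ , j) → e , L⊆N e∈ , j

  reach-edge : ∀ {L : List (Edge n)} {e} → e ∈ L → Reach L (lo e) (hi e)
  reach-edge {e = e} e∈ = (e , e∈ , inj₁ (refl , refl)) ◅ ε

  reach-joins : ∀ {L : List (Edge n)} e {u v u′ v′} → Joins e u v → Joins e u′ v′ →
                Reach L u v → Reach L u′ v′
  reach-joins e j j′ r with joins-unique e j j′
  ... | inj₁ (refl , refl) = r
  ... | inj₂ (refl , refl) = reach-sym r

  reach-cut : ∀ {L : List (Edge n)} {e u v} → Reach (e ∷ L) u v → Reach L (lo e) (hi e) → Reach L u v
  reach-cut {L} {e} p r = (bypass ⋆) p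
    where
    bypass : ∀ {u v} → Link (e ∷ L) u v → Reach L u v
    bypass (_ , here refl , j) = reach-joins e (inj₁ (refl , refl)) j r
    bypass (f , there f∈ , j)  = (f , f∈ , j) ◅ ε

  -- A path in `e ∷ L` can be shortened to cross e at most once: never, upwards or downwards. This
  -- makes reachability decidable by recursion on the edge list.
  Through : List (Edge n) → Edge n → Fin n → Fin n → Set
  Through L e u v = Reach L u v
                  ⊎ (Reach L u (lo e) × Reach L (hi e) v)
                  ⊎ (Reach L u (hi e) × Reach L (lo e) v)

  -- When the path starts with e and its remainder crosses e again, only the part after the later
  -- crossing is kept. It starts at an end of e.
  reach-∷⁻ : ∀ {L e u v} → Reach (e ∷ L) u v → Through L e u v
  reach-∷⁻ ε = inj₁ ε
  reach-∷⁻ ((f , there f∈ , j) ◅ p) =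
    Sum.map (l ◅_) (Sum.map (map₁ (l ◅_)) (map₁ (l ◅_))) (reach-∷⁻ p)
    where l = f , f∈ , j
  reach-∷⁻ ((_ , here refl , inj₁ (refl , refl)) ◅ p) with reach-∷⁻ p
  ... | inj₁ q              = inj₂ (inj₁ (ε , q))
  ... | inj₂ (inj₁ (_ , q)) = inj₂ (inj₁ (ε , q))
  ... | inj₂ (inj₂ (_ , q)) = inj₁ q
  reach-∷⁻ ((_ , here refl , inj₂ (refl , refl)) ◅ p) with reach-∷⁻ p
  ... | inj₁ q              = inj₂ (inj₂ (ε , q))
  ... | inj₂ (inj₁ (_ , q)) = inj₁ q
  ... | inj₂ (inj₂ (_ , q)) = inj₂ (inj₂ (ε , q))

  reach-∷⁺ : ∀ {L e u v} → Through L e u v → Reach (e ∷ L) u v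
  reach-∷⁺ (inj₁ p)              = reach-mono there p
  reach-∷⁺ (inj₂ (inj₁ (p , q))) =
    reach-mono there p ◅◅ reach-edge (here refl) ◅◅ reach-mono there q
  reach-∷⁺ (inj₂ (inj₂ (p , q))) =
    reach-mono there p ◅◅ reach-sym (reach-edge (here refl)) ◅◅ reach-mono there q

  reach? : ∀ L → Decidable (Reach {n} L)
  reach? []      u v = map′ (λ { refl → ε }) (λ { ε → refl ; ((_ , () , _) ◅ _) }) (u ≟ v)
  reach? (e ∷ L) u v = map′ reach-∷⁺ reach-∷⁻
    (reach? L u v ⊎-dec (reach? L u (lo e) ×-dec reach? L (hi e) v)
                  ⊎-dec (reach? L u (hi e) ×-dec reach? L (lo e) v))

  -- The path between the ends of x must cross y. Its two outer pieces, joined through x, connect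
  -- the ends of y.
  reach-exchange : ∀ {L : List (Edge n)} {x y} → Reach (y ∷ L) (lo x) (hi x) → ¬ Reach L (lo x) (hi x) →
                   Reach (x ∷ L) (lo y) (hi y)
  reach-exchange p ¬q with reach-∷⁻ p
  ... | inj₁ q              = contradiction q ¬q
  ... | inj₂ (inj₁ (a , b)) = reach-∷⁺ (inj₂ (inj₁ (reach-sym a , reach-sym b)))
  ... | inj₂ (inj₂ (a , b)) = reach-∷⁺ (inj₂ (inj₂ (b , a)))

  reach-isolated : ∀ {L : List (Edge n)} {u v} → (∀ {e} → e ∈ L → lo e ≢ u × hi e ≢ u) →
                   Reach L u v → u ≡ v
  reach-isolated iso ε                                = refl
  reach-isolated iso ((e , e∈ , inj₁ (lo≡ , _)) ◅ _) = contradiction lo≡ (proj₁ (iso e∈))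
  reach-isolated iso ((e , e∈ , inj₂ (_ , hi≡)) ◅ _) = contradiction hi≡ (proj₂ (iso e∈))

graphic : ∀ n → Matroid (Edge n)
graphic n = record
  { _∈cl_       = λ e L → Reach L (lo e) (hi e)
  ; _∈cl?_      = λ e L → reach? L (lo e) (hi e)
  ; cl-ext      = reach-edge
  ; cl-mono     = reach-mono
  ; cl-cut      = reach-cut
  ; cl-exchange = reach-exchange
  }

-- Rank and number of edges of a graph

module _ {n : ℕ} where
  open Rank (graphic n)

  -- Distinct edges with the same upper end have distinct lower ends, so the lower end of each edge
  -- is isolated in the rest of the star.
  star-rank : ∀ {v} {S : List (Edge n)} → Unique S → All (λ e → hi e ≡ v) S → rank S ≡ length S
  star-rank []                []            = refl
  star-rank {S = e ∷ S} (e∉ ∷ S!) (refl ∷ hi≡) =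
    ≡.trans (rank-∉cl λ p → lo≢hi e (reach-isolated isolated p)) (cong suc (star-rank S! hi≡))
    where
    isolated : ∀ {f} → f ∈ S → lo f ≢ lo e × hi f ≢ lo e
    isolated f∈ with All.lookup hi≡ f∈
    ... | refl = (λ { refl → All.lookup e∉ f∈ refl }) , λ hi≡lo → lo≢hi e (sym hi≡lo)

  rank-new-vertex : ∀ e {L : List (Edge n)} → (∀ {f} → f ∈ L → lo f ≢ hi e × hi f ≢ hi e) →
                    rank (e ∷ L) ≡ suc (rank L)
  rank-new-vertex e iso = rank-∉cl λ p → lo≢hi e (sym (reach-isolated iso (reach-sym p)))

  -- Delete the star at the largest vertex: it is independent, so it has at most
  -- rank L edges, and if it is nonempty its deletion lowers the rank.
  length≤rank-below : ∀ m {L : List (Edge n)} → Unique L → All (λ e → toℕ (hi e) ℕ.< m) L →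
                      2 * length L ≤ rank L * suc (rank L)
  length≤rank-below zero    {[]} _  _       = z≤n
  length≤rank-below zero    {_ ∷ _} _ (() ∷ _)
  length≤rank-below (suc m) {L} L! below = bound star refl
    where
    open ≤-Reasoning
    top?  = λ (e : Edge n) → toℕ (hi e) ℕ.≟ m
    star  = filter top? L
    rest  = filter (¬? ∘ top?) L
    rest-below : All (λ e → toℕ (hi e) ℕ.< m) rest
    rest-below = All.tabulate λ e∈ → let e∈L , hi≢m = ∈-filter⁻ (¬? ∘ top?) {xs = L} e∈ in
      ≤∧≢⇒< (≤-pred (All.lookup below e∈L)) hi≢m
    split : length L ≤ length star + length rest
    split = ≤-trans (pigeonhole L! cover) (≤-reflexive (length-++ star))
      where
      cover : L ⊆ star ++ rest
      cover {e} e∈ with top? e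
      ... | yes t = ∈-++⁺ˡ (∈-filter⁺ top? e∈ t)
      ... | no ¬t = ∈-++⁺ʳ star (∈-filter⁺ (¬? ∘ top?) e∈ ¬t)
    ih : 2 * length rest ≤ rank rest * suc (rank rest)
    ih = length≤rank-below m (unique-filter⁺ (¬? ∘ top?) L!) rest-below
    bound : ∀ S → S ≡ star → 2 * length L ≤ rank L * suc (rank L)
    bound [] eq = begin
      2 * length L                ≤⟨ *-monoʳ-≤ 2 split ⟩
      2 * (length star + length rest) ≡⟨ cong (λ S → 2 * (length S + length rest)) eq ⟨
      2 * length rest             ≤⟨ ih ⟩
      rank rest * suc (rank rest) ≤⟨ *-mono-≤ rest≤ (s≤s rest≤) ⟩
      rank L * suc (rank L)       ∎
      where rest≤ = rank-mono (filter-⊆ (¬? ∘ top?) L)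
    bound (e ∷ S) eq = begin
      2 * length L                            ≤⟨ *-monoʳ-≤ 2 split ⟩
      2 * (length star + length rest)         ≡⟨ *-distribˡ-+ 2 (length star) _ ⟩
      2 * length star + 2 * length rest       ≤⟨ +-mono-≤ (*-monoʳ-≤ 2 star≤) ih ⟩
      -- With r = `rank L`, the rest has rank at most r - 1, and 2r + (r - 1)r = r(r + 1): the count
      -- for a clique that gains a vertex.
      2 * rank L + rank rest * suc (rank rest) ≤⟨ +-monoʳ-≤ (2 * rank L) (*-monoʳ-≤ (rank rest) drop) ⟩
      2 * rank L + rank rest * rank L         ≡⟨ regroup (rank L) (rank rest) ⟩
      rank L * suc (suc (rank rest))          ≤⟨ *-monoʳ-≤ (rank L) (s≤s drop) ⟩
      rank L * suc (rank L)                   ∎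
      where
      regroup : ∀ a b → 2 * a + b * a ≡ a * suc (suc b)
      regroup = solve-∀
      e∈star : e ∈ star
      e∈star = subst (e ∈_) eq (here refl)
      e∈L  = proj₁ (∈-filter⁻ top? {xs = L} e∈star)
      hi-e = proj₂ (∈-filter⁻ top? {xs = L} e∈star)
      star≤ : length star ≤ rank L
      star≤ = ≤-trans (≤-reflexive (sym (star-rank (unique-filter⁺ top? L!) common)))
                      (rank-mono (filter-⊆ top? L))
        where
        common : All (λ f → hi f ≡ hi e) star
        common = All.tabulate λ f∈ →
          toℕ-injective (≡.trans (proj₂ (∈-filter⁻ top? {xs = L} f∈)) (sym hi-e))
      drop : suc (rank rest) ≤ rank L
      drop = ≤-trans (≤-reflexive (sym (rank-new-vertex e isolated)))
                     (rank-mono λ { (here refl) → e∈L ; (there f∈) → filter-⊆ (¬? ∘ top?) L f∈ })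
        where
        -- `hi e` is vertex m, which is above the upper end of f and hence above its lower end.
        isolated : ∀ {f} → f ∈ rest → lo f ≢ hi e × hi f ≢ hi e
        isolated {edge u v u<v} f∈ =
          (λ { refl → <-asym (recompute (u <? v) u<v) (subst (toℕ v ℕ.<_) (sym hi-e) hi<) }) ,
          λ { refl → <-irrefl hi-e hi< }
          where hi< = All.lookup rest-below f∈

  length≤rank : ∀ {L : List (Edge n)} → Unique L → 2 * length L ≤ rank L * suc (rank L)
  length≤rank {L} L! = length≤rank-below n L! (All.tabulate λ {e} _ → toℕ<n (hi e))

  -- Independence is expressed as `length L ≤ rank L`; the reverse inequality is `rank≤length`.
  independent-∷⁻ : ∀ {e L} → length (e ∷ L) ≤ rank (e ∷ L) →
                   ¬ Reach L (lo e) (hi e) × length L ≤ rank L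
  independent-∷⁻ {e} {L} indep =
    (λ p → <⇒≱ (≤-trans indep (≤-reflexive (rank-∈cl p))) (rank≤length L)) ,
    ≤-pred (≤-trans indep (rank-∷-≤ e L))

  independent⇒unique : ∀ {L} → length L ≤ rank L → Unique L
  independent⇒unique {[]}    _     = []
  independent⇒unique {e ∷ L} indep with e∉ , indep′ ← independent-∷⁻ indep =
    All.tabulate (λ { f∈ refl → e∉ (reach-edge f∈) }) ∷ independent⇒unique indep′

  -- Rank ignores order, so any edge can be brought to the front, where independence puts it outside
  -- the closure of the others.
  independent⇒bridge : ∀ {e} K L → length (K ++ e ∷ L) ≤ rank (K ++ e ∷ L) →
                       ¬ Reach (K ++ L) (lo e) (hi e)
  independent⇒bridge {e} K L indep = proj₁ (independent-∷⁻ (begin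
    suc (length (K ++ L)) ≡⟨ ↭-length (shift e K L) ⟨
    length (K ++ e ∷ L)   ≤⟨ indep ⟩
    rank (K ++ e ∷ L)     ≡⟨ rank-↭ (shift e K L) ⟩
    rank (e ∷ K ++ L)     ∎))
    where
    open ≤-Reasoning

module _ {m : ℕ} where
  open Rank (graphic (suc m))

  -- The m edges at vertex `zero` already span every edge.
  rank≤ : ∀ L → rank L ≤ m
  rank≤ L = begin
    rank L            ≤⟨ rank-mono-cl (All.tabulate {xs = L} λ {e} _ → spanned e) ⟩
    rank star         ≤⟨ rank≤length star ⟩
    length star       ≡⟨ length-map spoke (allFin m) ⟩
    length (allFin m) ≡⟨ length-tabulate id ⟩
    m                 ∎
    where
    open ≤-Reasoning
    spoke : Fin m → Edge (suc m)
    spoke i = edge zero (suc i) ℕ.z<s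
    star = map spoke (allFin m)
    from-zero : ∀ v → Reach star zero v
    from-zero zero    = ε
    from-zero (suc i) = reach-edge (∈-map⁺ spoke (∈-allFin i))
    spanned : ∀ e → Reach star (lo e) (hi e)
    spanned e = reach-sym (from-zero (lo e)) ◅◅ from-zero (hi e)

  full-rank⇒spanned : ∀ {L} → m ≤ rank L → ∀ e → Reach L (lo e) (hi e)
  full-rank⇒spanned {L} full e = decidable-stable (reach? L (lo e) (hi e)) λ ¬p →
    <⇒≱ (≤-trans (s≤s full) (≤-reflexive (sym (rank-∉cl ¬p)))) (rank≤ (e ∷ L))

  full-rank⇒reach : ∀ {L} → m ≤ rank L → ∀ u v → Reach L u v
  full-rank⇒reach {L} full u v with <-cmp u v
  ... | tri≈ _ refl _ = ε
  ... | tri< u<v _ _  = full-rank⇒spanned full (edge u v u<v)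
  ... | tri> _ _ v<u  = reach-sym (full-rank⇒spanned full (edge v u v<u))

-- Counting edges by colour

length-cartesianProduct : ∀ {A B : Set} (xs : List A) (ys : List B) →
                          length (cartesianProduct xs ys) ≡ length xs * length ys
length-cartesianProduct []       ys = refl
length-cartesianProduct (x ∷ xs) ys = ≡.trans (length-++ (map (x ,_) ys))
  (cong₂ _+_ (length-map (x ,_) ys) (length-cartesianProduct xs ys))

length-concat-replicate : ∀ {A : Set} n (xs : List A) → length (concat (replicate n xs)) ≡ n * length xs
length-concat-replicate zero    xs = refl
length-concat-replicate (suc n) xs =
  ≡.trans (length-++ xs) (cong (length xs +_) (length-concat-replicate n xs))

select-⊆ : ∀ {A : Set} (xs : List A) p → Sublist _≡_ (select xs p) xs
select-⊆ []       []            = []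
select-⊆ (x ∷ xs) (inside  ∷ p) = refl ∷ select-⊆ xs p
select-⊆ (x ∷ xs) (outside ∷ p) = x ∷ʳ select-⊆ xs p

module _ {k : ℕ} where

  fibre : ∀ {A : Set} → (A → Fin k) → Fin k → List A → List A
  fibre f i = filter (λ x → f x ≟ i)

  ∈-fibre⁻ : ∀ {A : Set} (f : A → Fin k) i xs {x} → x ∈ fibre f i xs → x ∈ xs × f x ≡ i
  ∈-fibre⁻ f i xs = ∈-filter⁻ (λ x → f x ≟ i) {xs = xs}

  indicator : Fin k → Fin k → ℕ
  indicator i j = if does (i ≟ j) then 1 else 0

  length-fibre-∷ : ∀ {A : Set} (f : A → Fin k) i x xs →
                   length (fibre f i (x ∷ xs)) ≡ indicator (f x) i + length (fibre f i xs)
  length-fibre-∷ f i x xs with does (f x ≟ i)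
  ... | true  = refl
  ... | false = refl

sum-indicator : ∀ {k} (i : Fin k) → sum (indicator i) ≡ 1
sum-indicator {suc k} zero    = cong suc (sum-replicate-zero k)
sum-indicator {suc k} (suc i) = sum-indicator i

sum-mono : ∀ {k} {f g : Fin k → ℕ} → (∀ i → f i ≤ g i) → sum f ≤ sum g
sum-mono {zero}  f≤g = z≤n
sum-mono {suc k} f≤g = +-mono-≤ (f≤g zero) (sum-mono (f≤g ∘ suc))

module _ {k : ℕ} where

  length≡sum-fibres : ∀ {A : Set} (f : A → Fin k) xs → length xs ≡ sum (λ i → length (fibre f i xs))
  length≡sum-fibres f []       = sym (sum-replicate-zero k)
  length≡sum-fibres f (x ∷ xs) = begin
    suc (length xs)
      ≡⟨ cong₂ _+_ (sym (sum-indicator (f x))) (length≡sum-fibres f xs) ⟩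
    sum (indicator (f x)) + sum (λ i → length (fibre f i xs))
      ≡⟨ ∑-distrib-+ (indicator (f x)) _ ⟨
    sum (λ i → indicator (f x) i + length (fibre f i xs))
      ≡⟨ sum-cong-≗ (λ i → length-fibre-∷ f i x xs) ⟨
    sum (λ i → length (fibre f i (x ∷ xs))) ∎
    where open ≡.≡-Reasoning

  -- Stated for two element types because it compares edges with colours (for `class-large`) and
  -- colours with edges (for `union-large`).
  fibrewise-≤ : ∀ {A B : Set} (f : A → Fin k) (g : B → Fin k) a b xs ys →
                (∀ i → a * length (fibre f i xs) ≤ b * length (fibre g i ys)) →
                a * length xs ≤ b * length ys
  fibrewise-≤ f g a b xs ys le = begin
    a * length xs                             ≡⟨ cong (a *_) (length≡sum-fibres f xs) ⟩
    a * sum (λ i → length (fibre f i xs))     ≡⟨ *-distribˡ-sum a (λ i → length (fibre f i xs)) ⟩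
    sum (λ i → a * length (fibre f i xs))     ≤⟨ sum-mono le ⟩
    sum (λ i → b * length (fibre g i ys))     ≡⟨ *-distribˡ-sum b (λ i → length (fibre g i ys)) ⟨
    b * sum (λ i → length (fibre g i ys))     ≡⟨ cong (b *_) (length≡sum-fibres g ys) ⟨
    b * length ys                             ∎
    where open ≤-Reasoning

  length-fibre-allFin : ∀ i → length (fibre id i (allFin k)) ≡ 1
  length-fibre-allFin i = ≤-antisym
    (pigeonhole {ys = i ∷ []} (unique-filter⁺ (_≟ i) (allFin⁺ k))
      λ j∈ → here (proj₂ (∈-fibre⁻ id i (allFin k) j∈)))
    (pigeonhole {xs = i ∷ []} ([] ∷ []) λ { (here refl) → ∈-filter⁺ (_≟ i) (∈-allFin i) refl })

  length-fibre-copies : ∀ n i → length (fibre id i (concat (replicate n (allFin k)))) ≡ n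
  length-fibre-copies zero    i = refl
  length-fibre-copies (suc n) i = begin
    length (fibre id i (allFin k ++ rest))
      ≡⟨ cong length (filter-++ (_≟ i) (allFin k) rest) ⟩
    length (fibre id i (allFin k) ++ fibre id i rest)
      ≡⟨ length-++ (fibre id i (allFin k)) ⟩
    length (fibre id i (allFin k)) + length (fibre id i rest)
      ≡⟨ cong₂ _+_ (length-fibre-allFin i) (length-fibre-copies n i) ⟩
    suc n ∎
    where
    open ≡.≡-Reasoning
    rest = concat (replicate n (allFin k))

  length-fibre-Pointwise : ∀ {A B : Set} {f : A → Fin k} {g : B → Fin k} {xs ys} i →
    Pointwise (λ x y → f x ≡ g y) xs ys → length (fibre f i xs) ≡ length (fibre g i ys)
  length-fibre-Pointwise i []                        = refl
  length-fibre-Pointwise {f = f} {g} i (_∷_ {x} {y} {xs} {ys} eq rel) = begin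
    length (fibre f i (x ∷ xs))
      ≡⟨ length-fibre-∷ f i x xs ⟩
    indicator (f x) i + length (fibre f i xs)
      ≡⟨ cong₂ (λ j l → indicator j i + l) eq (length-fibre-Pointwise i rel) ⟩
    indicator (g y) i + length (fibre g i ys)
      ≡⟨ length-fibre-∷ g i y ys ⟨
    length (fibre g i (y ∷ ys)) ∎
    where open ≡.≡-Reasoning

-- Every ordered pair is an edge read upwards, an edge read downwards, or a loop.
n*n≤2*length-allEdges+n : ∀ n → n * n ≤ 2 * length (allEdges n) + n
n*n≤2*length-allEdges+n n = begin
  n * n
    ≡⟨ cong (λ l → l * l) (length-tabulate {n = n} id) ⟨
  length (allFin n) * length (allFin n)
    ≡⟨ length-cartesianProduct (allFin n) (allFin n) ⟨
  length (cartesianProduct (allFin n) (allFin n))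
    ≤⟨ pigeonhole (cartesianProduct⁺ (allFin⁺ n) (allFin⁺ n)) (λ {p} _ → cover p) ⟩
  length (ups ++ downs ++ loops)
    ≡⟨ length-++ ups ⟩
  length ups + length (downs ++ loops)
    ≡⟨ cong₂ _+_ (length-map _ (allEdges n)) (length-++ downs) ⟩
  length (allEdges n) + (length downs + length loops)
    ≡⟨ cong (length (allEdges n) +_) (cong₂ _+_ (length-map _ (allEdges n)) length-loops) ⟩
  length (allEdges n) + (length (allEdges n) + n)
    ≡⟨ regroup (length (allEdges n)) n ⟩
  2 * length (allEdges n) + n ∎
  where
  open ≤-Reasoning
  regroup : ∀ a b → a + (a + b) ≡ 2 * a + b
  regroup = solve-∀
  ups downs loops : List (Fin n × Fin n)
  ups   = map (λ e → lo e , hi e) (allEdges n)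
  downs = map (λ e → hi e , lo e) (allEdges n)
  loops = map (λ v → v , v) (allFin n)
  length-loops : length loops ≡ n
  length-loops = ≡.trans (length-map _ (allFin n)) (length-tabulate id)
  cover : ∀ p → p ∈ ups ++ downs ++ loops
  cover (u , v) with <-cmp u v
  ... | tri< u<v _ _  = ∈-++⁺ˡ (∈-map⁺ _ (∈-allEdges (edge u v u<v)))
  ... | tri≈ _ refl _ = ∈-++⁺ʳ ups (∈-++⁺ʳ downs (∈-map⁺ _ (∈-allFin u)))
  ... | tri> _ _ v<u  = ∈-++⁺ʳ ups (∈-++⁺ˡ (∈-map⁺ _ (∈-allEdges (edge v u v<u))))

-- Spanning trees from independent edge lists

module _ {n : ℕ} (xs : List (Edge n)) where
  open Rank (graphic n)
  open DecMembership (_≟ᵉ_ {n}) using (_∈?_)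

  subgraph : SpanningSubgraph n
  subgraph e = isYes (e ∈? xs)

  colourCount-subgraph : ∀ {k} (c : EdgeColouring n k) → Unique xs → ∀ i →
                         colourCount c subgraph i ≡ length (fibre c i xs)
  colourCount-subgraph c xs! i = ≤-antisym
    (pigeonhole (unique-filter⁺ _ (unique-filter⁺ _ (allEdges-unique n)))
      (filter⁺′ _ _ id λ e∈ → toWitness (proj₂ (∈-filter⁻ _ {xs = allEdges n} e∈))))
    (pigeonhole (unique-filter⁺ _ xs!)
      (filter⁺′ _ _ id λ {e} e∈ → ∈-filter⁺ _ (∈-allEdges e) (fromWitness e∈)))

  reach⇒connected : (∀ u v → Reach xs u v) → Connected subgraph
  reach⇒connected r u v = Star.map (λ (e , e∈ , j) → e , fromWitness e∈ , j) (r u v)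

  -- Without its closing edge e, a cycle is a path between the ends of e that avoids e, but e is a
  -- bridge.
  independent⇒acyclic : length xs ≤ rank xs → ¬ Cycle subgraph
  independent⇒acyclic indep C with e , t , j ← Cycle.close C with K , L , eq ← ∈-∃++ (toWitness t) =
    independent⇒bridge K L (subst (λ ys → length ys ≤ rank ys) eq indep)
      (reach-joins e j (inj₁ (refl , refl)) (reach-sym path))
    where
    open Cycle C
    walk : ∀ k (f : Fin (suc k) → Fin n) → (∀ i → Link (K ++ L) (f (inject₁ i)) (f (suc i))) →
           Reach (K ++ L) (f zero) (f (fromℕ k))
    walk zero    f links = ε
    walk (suc k) f links = links zero ◅ walk k (f ∘ suc) (links ∘ suc)

    -- No step starts at the last vertex, and the step from the first vertex ends at the second,
    -- which is not the last because a cycle has at least three vertices.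
    not-close : ∀ i → ¬ Joins e (vertex (inject₁ i)) (vertex (suc i))
    not-close i j′ with joins-unique e j j′
    ... | inj₁ (last≡ , _)     = fromℕ≢inject₁ (distinct last≡)
    ... | inj₂ (last≡ , zero≡) with distinct last≡ | distinct zero≡
    not-close zero    j′ | inj₂ _ | () | _
    not-close (suc i) j′ | inj₂ _ | _  | ()

    link : ∀ i → Link (K ++ L) (vertex (inject₁ i)) (vertex (suc i))
    link i with f , t′ , j′ ← step i with ∈-++⁻ K (subst (f ∈_) eq (toWitness t′))
    ... | inj₁ f∈K         = f , ∈-++⁺ˡ f∈K , j′
    ... | inj₂ (there f∈L) = f , ∈-++⁺ʳ K f∈L , j′
    ... | inj₂ (here refl) = contradiction j′ (not-close i)

    path : Reach (K ++ L) (vertex zero) (vertex (fromℕ (2 + Cycle.m C)))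
    path = walk _ vertex link

-- Rado's condition for the colour classes

module _ {m k t : ℕ} (m≡2kt : m ≡ 2 * k * t)
         (c : EdgeColouring (suc m) k) (balanced : ColourBalanced c (complete (suc m))) where
  open Rank (graphic (suc m))
  open DecMembership (_≟_ {k}) using () renaming (_∈?_ to _∈ᶜ?_)

  private
    E = allEdges (suc m)

    class : Fin k → List (Edge (suc m))
    class i = fibre c i E

    class-balanced : ∀ i j → length (class i) ≡ length (class j)
    -- `edges` of the complete graph is `allEdges` filtered by a constantly true test; `filter-all`
    -- removes that filter.
    class-balanced i j = subst (λ L → length (fibre c i L) ≡ length (fibre c j L))
      (filter-all _ (All.tabulate {xs = E} λ _ → _)) (balanced i j)

    class-large : ∀ j → suc m * t ≤ length (class j)
    class-large j = *-cancelˡ-≤ (2 * k) {{k≢0 j}} (begin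
      2 * k * (suc m * t)           ≡⟨ regroup₁ k (suc m) t ⟩
      suc m * (2 * k * t)           ≡⟨ cong (suc m *_) m≡2kt ⟨
      suc m * m                     ≤⟨ +-cancelʳ-≤ (suc m) _ _ edges≥ ⟩
      2 * length E                  ≤⟨ *-monoʳ-≤ 2 E≤ ⟩
      2 * (length (class j) * k)    ≡⟨ regroup₂ (length (class j)) k ⟩
      2 * k * length (class j)      ∎)
      where
      open ≤-Reasoning
      regroup₁ : ∀ a b d → 2 * a * (b * d) ≡ b * (2 * a * d)
      regroup₁ = solve-∀
      regroup₂ : ∀ a b → 2 * (a * b) ≡ 2 * b * a
      regroup₂ = solve-∀
      -- The colour j itself shows that k is positive, so that 2k can be cancelled.
      k≢0 : Fin k → NonZero (2 * k)
      k≢0 zero    = _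
      k≢0 (suc _) = _
      edges≥ : suc m * m + suc m ≤ 2 * length E + suc m
      edges≥ = ≤-trans (≤-reflexive (≡.trans (+-comm (suc m * m) (suc m)) (sym (*-suc (suc m) m))))
                       (n*n≤2*length-allEdges+n (suc m))
      E≤ : length E ≤ length (class j) * k
      E≤ = begin
        length E                            ≡⟨ *-identityˡ (length E) ⟨
        1 * length E                        ≤⟨ fibrewise-≤ c id 1 (length (class j)) E (allFin k) le ⟩
        length (class j) * length (allFin k) ≡⟨ cong (length (class j) *_) (length-tabulate id) ⟩
        length (class j) * k                ∎
        where
        le : ∀ i → 1 * length (class i) ≤ length (class j) * length (fibre id i (allFin k))
        le i = ≤-reflexive (≡.trans (*-identityˡ _) (≡.trans (class-balanced i j)
          (≡.trans (sym (*-identityʳ _)) (cong (length (class j) *_) (sym (length-fibre-allFin i))))))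

    colours : List (Fin k)
    colours = concat (replicate (2 * t) (allFin k))

    length-colours : length colours ≡ m
    length-colours = begin
      length colours             ≡⟨ length-concat-replicate (2 * t) (allFin k) ⟩
      2 * t * length (allFin k)  ≡⟨ cong (2 * t *_) (length-tabulate id) ⟩
      2 * t * k                  ≡⟨ regroup t k ⟩
      2 * k * t                  ≡⟨ m≡2kt ⟨
      m                          ∎
      where
      open ≡.≡-Reasoning
      regroup : ∀ a b → 2 * a * b ≡ 2 * b * a
      regroup = solve-∀

    -- Filtered out of `E` so that each edge is listed once, as `length≤rank` demands;
    -- `selectMap class` repeats a class for every chosen copy of its colour.
    union : List (Fin k) → List (Edge (suc m))
    union is = filter (λ e → c e ∈ᶜ? is) E

    union-large : ∀ p → suc m * length (select colours p) ≤ 2 * length (union (select colours p))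
    union-large p = fibrewise-≤ id c (suc m) 2 chosen (union chosen) le
      where
      chosen = select colours p
      le : ∀ i → suc m * length (fibre id i chosen) ≤ 2 * length (fibre c i (union chosen))
      le i with i ∈ᶜ? chosen
      ... | no  i∉ = ≤-trans (≤-reflexive vanishes) z≤n
        where
        empty : fibre id i chosen ≡ []
        empty = filter-none (_≟ i) (All.tabulate λ { j∈ refl → i∉ j∈ })
        vanishes : suc m * length (fibre id i chosen) ≡ 0
        vanishes = ≡.trans (cong (λ L → suc m * length L) empty) (*-zeroʳ (suc m))
      ... | yes i∈ = begin
        suc m * length (fibre id i chosen)      ≤⟨ *-monoʳ-≤ (suc m) (Sublist.length-mono-≤ fibre-⊆) ⟩
        suc m * length (fibre id i colours)     ≡⟨ cong (suc m *_) (length-fibre-copies (2 * t) i) ⟩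
        suc m * (2 * t)                         ≡⟨ regroup (suc m) t ⟩
        2 * (suc m * t)                         ≤⟨ *-monoʳ-≤ 2 (class-large i) ⟩
        2 * length (class i)                    ≤⟨ *-monoʳ-≤ 2 (pigeonhole class! keep) ⟩
        2 * length (fibre c i (union chosen))   ∎
        where
        open ≤-Reasoning
        regroup : ∀ a b → a * (2 * b) ≡ 2 * (a * b)
        regroup = solve-∀
        fibre-⊆ : Sublist _≡_ (fibre id i chosen) (fibre id i colours)
        fibre-⊆ = Sublist.⊆-filter-Sublist (_≟ i) (_≟ i) (λ { refl → id }) (select-⊆ colours p)
        class! : Unique (class i)
        class! = unique-filter⁺ _ (allEdges-unique (suc m))
        keep : class i ⊆ fibre c i (union chosen)
        keep {e} e∈ with e∈E , refl ← ∈-fibre⁻ c i E e∈ =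
          ∈-filter⁺ _ (∈-filter⁺ (λ e → c e ∈ᶜ? chosen) e∈E i∈) refl

    rado-condition : RadoCondition class colours []
    rado-condition p = begin
      ∣ p ∣ + 0                               ≡⟨ +-identityʳ ∣ p ∣ ⟩
      ∣ p ∣                                   ≡⟨ length-select colours p ⟨
      s                                       ≤⟨ ≮⇒≥ too-small ⟩
      r                                       ≤⟨ rank-mono L⊆ ⟩
      rank (selectMap class colours p)        ≡⟨ cong rank (++-identityʳ (selectMap class colours p)) ⟨
      rank (selectMap class colours p ++ [])  ∎
      where
      open ≤-Reasoning
      chosen = select colours p
      L = union chosen
      s = length chosen
      r = rank L
      L⊆ : L ⊆ selectMap class colours p
      L⊆ {e} e∈ with e∈E , ce∈ ← ∈-filter⁻ (λ e → c e ∈ᶜ? chosen) {xs = E} e∈ =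
        ∈-concatMap⁺ class (Any.map (λ { refl → ∈-filter⁺ (λ e′ → c e′ ≟ c e) e∈E refl }) ce∈)
      s≤m : s ≤ m
      s≤m = ≤-trans (Sublist.length-mono-≤ (select-⊆ colours p)) (≤-reflexive length-colours)
      -- From (m + 1)s ≤ r(r + 1) ≤ rs, cancelling s leaves m + 1 ≤ r, against r < s ≤ m.
      too-small : ¬ r ℕ.< s
      too-small r<s = <⇒≱ (≤-trans r<s (≤-trans s≤m (n≤1+n m)))
        (*-cancelʳ-≤ (suc m) r s {{ℕ.>-nonZero (≤-trans (s≤s z≤n) r<s)}} (begin
          suc m * s      ≤⟨ union-large p ⟩
          2 * length L   ≤⟨ length≤rank (unique-filter⁺ _ (allEdges-unique (suc m))) ⟩
          r * suc r      ≤⟨ *-monoʳ-≤ r r<s ⟩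
          r * s          ∎))

  balanced-tree : ∃[ G ] (IsSpanningTree G × ColourBalanced c G)
  balanced-tree with xs , xs∈ , full ← rado class colours [] rado-condition =
    subgraph xs , (reach⇒connected xs (full-rank⇒reach spans) , independent⇒acyclic xs independent) ,
    λ i j → ≡.trans (count i) (sym (count j))
    where
    -- Here m is both the largest possible rank and the length of `xs`.
    spans : m ≤ rank xs
    spans = subst₂ (λ a L → a ≤ rank L) (≡.trans (+-identityʳ _) length-colours) (++-identityʳ xs) full
    independent : length xs ≤ rank xs
    independent = subst (_≤ rank xs) (sym length-xs) spans
      where length-xs = ≡.trans (Pointwise.Pointwise-length xs∈) length-colours
    -- The entries of `xs` have the colours listed in `colours`, in the same order; uniqueness
    -- ensures that the subgraph loses none of them.
    count : ∀ i → colourCount c (subgraph xs) i ≡ 2 * t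
    count i = ≡.trans (colourCount-subgraph xs c (independent⇒unique independent) i)
      (≡.trans (length-fibre-Pointwise i (Pointwise.map (λ {x} {j} x∈ → proj₂ (∈-fibre⁻ c j E x∈)) xs∈))
               (length-fibre-copies (2 * t) i))

corollary1p8 : (k t : ℕ) → k ≥ 1 → t ≥ 1 →
    (c : EdgeColouring (2 * k * t + 1) k) →
    ColourBalanced c (complete (2 * k * t + 1)) →
    ∃[ G ] (IsSpanningTree G × ColourBalanced c G)
corollary1p8 k t _ _ =
  subst (λ n → (c : EdgeColouring n k) → ColourBalanced c (complete n) →
               ∃[ G ] (IsSpanningTree G × ColourBalanced c G))
        (+-comm 1 (2 * k * t)) (λ c → balanced-tree {t = t} refl c)
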